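{- Let $\mathcal{A}$ be a cocomplete category and let $(\mathcal{V},\otimes,I)$ be a small monoidal category acting on $\mathcal{A}$ via $\triangleleft\colon \mathcal{V}\times\mathcal{A}\to\mathcal{A}$. Let $J_I\in\mathcal{A}$ be an object such that the functor $J\colon\mathcal{V}\to\mathcal{A}$, $JV = V\triangleleft J_I$, is well-behaved for $(-)\triangleleft A\colon \mathcal{V}\to\mathcal{A}$ for every $A\in\mathcal{A}$, and let a natural isomorphism $\mathbf{a}\colon (V\triangleleft A)\triangleleft_J B\cong V\triangleleft (A\triangleleft_J B)$ (for $V\in\mathcal V$, $A,B\in\mathcal A$) be given. Suppose that for all $A,B\in\mathcal{A}$ the presheaf $\mathcal{A}((-)\triangleleft A,B)\in[\mathcal{V}^{\mathrm{op}},\mathbf{Set}]$ is a fixed point of the monad $\nu_J\mathrm{Lan}_J$, that is, there is an isomorphism $$\nu_J\mathrm{Lan}_J\,\mathcal{A}((-)\triangleleft A,B)\;\cong\;\mathcal{A}((-)\triangleleft A,B).$$ Then defining $[A,B]_{\diamond}:=\mathrm{Lan}_J(\mathcal{A}((-)\triangleleft A,B))$ yields an adjunction $$\mathcal{A}(A\triangleleft_J B,C)\;\cong\;\mathcal{A}(A,[B,C]_{\diamond}).$$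
   Context: A (left) action of a monoidal category $(\mathcal{V},\otimes,I)$ on a category $\mathcal{A}$ is a functor $\triangleleft\colon\mathcal{V}\times\mathcal{A}\to\mathcal{A}$ with natural isomorphisms $I\triangleleft A\cong A$ and $V\triangleleft(U\triangleleft A)\cong(V\otimes U)\triangleleft A$ satisfying coherence conditions analogous to those of monoidal categories. For a set $S$ and an object $A$ of a cocomplete category, $S\cdot A$ denotes the copower $\coprod_{s\in S}A$. The $J$-extension of the action is the bifunctor $A\triangleleft_J B=\int^{V\in\mathcal{V}}\mathcal{A}(JV,A)\cdot(V\triangleleft B)$ on $\mathcal{A}$. The nerve functor of $J$ is $\nu_J\colon\mathcal{A}\to[\mathcal{V}^{\mathrm{op}},\mathbf{Set}]$, $\nu_JA=\mathcal{A}(J(-),A)$. It has a left adjoint, here written $\mathrm{Lan}_J\colon[\mathcal{V}^{\mathrm{op}},\mathbf{Set}]\to\mathcal{A}$ (the left Kan extension of $J$ along the Yoneda embedding), given on presheaves by $X\mapsto\int^{V\in\mathcal{V}}XV\cdot JV$; thus $\nu_J\mathrm{Lan}_J$ is a monad on $[\mathcal{V}^{\mathrm{op}},\mathbf{Set}]$. A functor $J\colon\mathcal{V}\to\mathcal{A}$ is well-behaved for a functor $F\colon\mathcal{V}\to\mathcal{A}$ if $J$ is fully faithful, $J$ is dense (i.e. $\nu_J$ is fully faithful), and the nerve of $J$ preserves the left Kan extension of $F$ along $J$, that is, writing $(\mathrm{Lan}_JF)A=\int^{V}\mathcal{A}(JV,A)\cdot FV$ for functors $F$ on $\mathcal V$,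 one has $\mathrm{Lan}_J(\mathcal{A}(JV,F-))A\cong\mathcal{A}(JV,(\mathrm{Lan}_JF)A)$ for all $V\in\mathcal{V}$, $A\in\mathcal{A}$ (via the canonical comparison). -}

module Defs where

open import Data.Product using (Σ-syntax; _×_; _,_)
open import Data.Unit.Polymorphic using (⊤; tt)
open import Function.Bundles using (Func; _⟨$⟩_)
open import Function.Definitions using (Bijective)
open import Level using (Level; _⊔_) renaming (suc to lsuc)
open import Relation.Binary.Bundles using (Setoid)
open import Relation.Binary.Core using (Rel)
open import Relation.Binary.Structures using (IsEquivalence)
import Function.Construct.Composition as Composition
import Function.Construct.Identity as Identity
import Function.Relation.Binary.Setoid.Equality as FuncEquality
import Relation.Binary.Reasoning.Setoid as SetoidReasoning

private
  variable
    o o′ o″ o‴ ℓ ℓ′ ℓ″ ℓ‴ : Level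

-- Functors, natural transformations and colimit data are compared intensionally
-- (no-eta-equality, definitions by copatterns), which keeps type checking fast.

-- A category has hom-setoids, and Set of size ℓ is Setoids ℓ.  A locally small
-- category is thus a Category o ℓ, and a small one a Category ℓ ℓ.
record Category (o ℓ : Level) : Set (lsuc (o ⊔ ℓ)) where
  infix  4 _⇒_ _≈_
  infixr 9 _∘_
  field
    Obj : Set o
    _⇒_ : Obj → Obj → Set ℓ
    _≈_ : ∀ {A B} → Rel (A ⇒ B) ℓ
    id  : ∀ {A} → A ⇒ A
    _∘_ : ∀ {A B C} → B ⇒ C → A ⇒ B → A ⇒ C

    assoc     : ∀ {A B C D} {f : A ⇒ B} {g : B ⇒ C} {h : C ⇒ D} →
                (h ∘ g) ∘ f ≈ h ∘ (g ∘ f)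
    identityˡ : ∀ {A B} {f : A ⇒ B} → id ∘ f ≈ f
    identityʳ : ∀ {A B} {f : A ⇒ B} → f ∘ id ≈ f
    equiv     : ∀ {A B} → IsEquivalence (_≈_ {A} {B})
    ∘-resp-≈  : ∀ {A B C} {f h : B ⇒ C} {g i : A ⇒ B} →
                f ≈ h → g ≈ i → f ∘ g ≈ h ∘ i

  module Equiv {A B : Obj} = IsEquivalence (equiv {A} {B})

  hom : Obj → Obj → Setoid ℓ ℓ
  hom A B = record { isEquivalence = equiv {A} {B} }

  ∘-resp-≈ˡ : ∀ {A B C} {f h : B ⇒ C} {g : A ⇒ B} → f ≈ h → f ∘ g ≈ h ∘ g
  ∘-resp-≈ˡ p = ∘-resp-≈ p Equiv.refl

  ∘-resp-≈ʳ : ∀ {A B C} {f : B ⇒ C} {g i : A ⇒ B} → g ≈ i → f ∘ g ≈ f ∘ i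
  ∘-resp-≈ʳ p = ∘-resp-≈ Equiv.refl p

  module HomReasoning {A B : Obj} = SetoidReasoning (hom A B)

infix 10 _[_,_] _[_≈_] _[_∘_]

_[_,_] : (C : Category o ℓ) (A B : Category.Obj C) → Set ℓ
C [ A , B ] = Category._⇒_ C A B

_[_≈_] : (C : Category o ℓ) {A B : Category.Obj C} → Rel (C [ A , B ]) ℓ
C [ f ≈ g ] = Category._≈_ C f g

_[_∘_] : (C : Category o ℓ) {A B D : Category.Obj C} →
         C [ B , D ] → C [ A , B ] → C [ A , D ]
C [ f ∘ g ] = Category._∘_ C f g

Setoids : ∀ ℓ → Category (lsuc ℓ) ℓ
Setoids ℓ = record
  { Obj       = Setoid ℓ ℓ
  ; _⇒_       = Func
  ; _≈_       = λ {S} {T} → FuncEquality._≈_ S T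
  ; id        = λ {S} → Identity.function S
  ; _∘_       = λ g f → Composition.function f g
  ; assoc     = λ {_} {_} {_} {T} x → Setoid.refl T
  ; identityˡ = λ {_} {T} x → Setoid.refl T
  ; identityʳ = λ {_} {T} x → Setoid.refl T
  ; equiv     = λ {S} {T} → FuncEquality.isEquivalence S T
  ; ∘-resp-≈  = λ {_} {_} {T} {_} {h} {g} f≈h g≈i x →
                  Setoid.trans T (f≈h (g ⟨$⟩ x)) (Func.cong h (g≈i x))
  }

Op : Category o ℓ → Category o ℓ
Op C = record
  { Obj       = Obj
  ; _⇒_       = λ A B → B ⇒ A
  ; _≈_       = _≈_
  ; id        = id
  ; _∘_       = λ f g → g ∘ f
  ; assoc     = Equiv.sym assoc
  ; identityˡ = identityʳ
  ; identityʳ = identityˡ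
  ; equiv     = equiv
  ; ∘-resp-≈  = λ p q → ∘-resp-≈ q p
  }
  where open Category C

Product : Category o ℓ → Category o′ ℓ′ → Category (o ⊔ o′) (ℓ ⊔ ℓ′)
Product C D = record
  { Obj       = C.Obj × D.Obj
  ; _⇒_       = λ (A , A′) (B , B′) → C [ A , B ] × D [ A′ , B′ ]
  ; _≈_       = λ (f , f′) (g , g′) → C [ f ≈ g ] × D [ f′ ≈ g′ ]
  ; id        = C.id , D.id
  ; _∘_       = λ (f , f′) (g , g′) → C [ f ∘ g ] , D [ f′ ∘ g′ ]
  ; assoc     = C.assoc , D.assoc
  ; identityˡ = C.identityˡ , D.identityˡ
  ; identityʳ = C.identityʳ , D.identityʳ
  ; equiv     = record
    { refl  = C.Equiv.refl , D.Equiv.refl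
    ; sym   = λ (p , p′) → C.Equiv.sym p , D.Equiv.sym p′
    ; trans = λ (p , p′) (q , q′) → C.Equiv.trans p q , D.Equiv.trans p′ q′
    }
  ; ∘-resp-≈  = λ (p , p′) (q , q′) → C.∘-resp-≈ p q , D.∘-resp-≈ p′ q′
  }
  where
  module C = Category C
  module D = Category D

module _ (C : Category o ℓ) where
  open Category C

  record IsIso {A B : Obj} (f : A ⇒ B) : Set ℓ where
    field
      inv  : B ⇒ A
      isoˡ : inv ∘ f ≈ id
      isoʳ : f ∘ inv ≈ id

  record Iso (A B : Obj) : Set ℓ where
    field
      to    : A ⇒ B
      isIso : IsIso to
    open IsIso isIso public renaming (inv to from)

record Functor (C : Category o ℓ) (D : Category o′ ℓ′) : Set (o ⊔ ℓ ⊔ o′ ⊔ ℓ′) where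
  no-eta-equality
  private
    module C = Category C
    module D = Category D
  field
    F₀ : C.Obj → D.Obj
    F₁ : ∀ {A B} → C [ A , B ] → D [ F₀ A , F₀ B ]

    identity     : ∀ {A} → D [ F₁ (C.id {A}) ≈ D.id ]
    homomorphism : ∀ {X Y Z} {f : C [ X , Y ]} {g : C [ Y , Z ]} →
                   D [ F₁ (C [ g ∘ f ]) ≈ D [ F₁ g ∘ F₁ f ] ]
    F-resp-≈     : ∀ {A B} {f g : C [ A , B ]} → C [ f ≈ g ] → D [ F₁ f ≈ F₁ g ]

open Functor public using (F₀; F₁)
open Functor using (identity; homomorphism; F-resp-≈)

idF : {C : Category o ℓ} → Functor C C
idF .F₀ X = X
idF .F₁ f = f
idF {C = C} .identity     = Category.Equiv.refl C
idF {C = C} .homomorphism = Category.Equiv.refl C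
idF .F-resp-≈ p = p

infixr 9 _∘F_
infixr 8 _⁂_

_∘F_ : {C : Category o ℓ} {D : Category o′ ℓ′} {E : Category o″ ℓ″} →
       Functor D E → Functor C D → Functor C E
(G ∘F F) .F₀ X = F₀ G (F₀ F X)
(G ∘F F) .F₁ f = F₁ G (F₁ F f)
_∘F_ {E = E} G F .identity     =
  Category.Equiv.trans E (F-resp-≈ G (identity F)) (identity G)
_∘F_ {E = E} G F .homomorphism =
  Category.Equiv.trans E (F-resp-≈ G (homomorphism F)) (homomorphism G)
(G ∘F F) .F-resp-≈ p = F-resp-≈ G (F-resp-≈ F p)

opF : {C : Category o ℓ} {D : Category o′ ℓ′} → Functor C D → Functor (Op C) (Op D)
opF F .F₀           = F₀ F
opF F .F₁           = F₁ F
opF F .identity     = identity F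
opF F .homomorphism = homomorphism F
opF F .F-resp-≈     = F-resp-≈ F

_⁂_ : {C : Category o ℓ} {C′ : Category o′ ℓ′} {D : Category o″ ℓ″} {D′ : Category o‴ ℓ‴} →
      Functor C C′ → Functor D D′ → Functor (Product C D) (Product C′ D′)
(F ⁂ G) .F₀ (X , Y)       = F₀ F X , F₀ G Y
(F ⁂ G) .F₁ (f , g)       = F₁ F f , F₁ G g
(F ⁂ G) .identity         = identity F , identity G
(F ⁂ G) .homomorphism     = homomorphism F , homomorphism G
(F ⁂ G) .F-resp-≈ (p , q) = F-resp-≈ F p , F-resp-≈ G q

assocF : {C : Category o ℓ} {D : Category o′ ℓ′} {E : Category o″ ℓ″} →
         Functor (Product C (Product D E)) (Product (Product C D) E)
assocF .F₀ (X , Y , Z) = (X , Y) , Z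
assocF .F₁ (f , g , h) = (f , g) , h
assocF {C = C} {D} {E} .identity     =
  (Category.Equiv.refl C , Category.Equiv.refl D) , Category.Equiv.refl E
assocF {C = C} {D} {E} .homomorphism =
  (Category.Equiv.refl C , Category.Equiv.refl D) , Category.Equiv.refl E
assocF .F-resp-≈ (p , q , r) = (p , q) , r

constF : {C : Category o ℓ} {D : Category o′ ℓ′} → Category.Obj D → Functor C D
constF X .F₀ _ = X
constF {D = D} X .F₁ _        = Category.id D
constF {D = D} X .identity     = Category.Equiv.refl D
constF {D = D} X .homomorphism = Category.Equiv.sym D (Category.identityˡ D)
constF {D = D} X .F-resp-≈ _   = Category.Equiv.refl D

module _ {C : Category o ℓ} {D : Category o′ ℓ′} {E : Category o″ ℓ″} where
  private
    module C = Category C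
    module D = Category D
    module E = Category E

  -- T(X , −)
  appˡ : Functor (Product C D) E → C.Obj → Functor D E
  appˡ T X .F₀ Y = F₀ T (X , Y)
  appˡ T X .F₁ g = F₁ T (C.id , g)
  appˡ T X .identity     = identity T
  appˡ T X .homomorphism = E.Equiv.trans
    (F-resp-≈ T (C.Equiv.sym C.identityˡ , D.Equiv.refl)) (homomorphism T)
  appˡ T X .F-resp-≈ p   = F-resp-≈ T (C.Equiv.refl , p)

  -- T(− , Y)
  appʳ : Functor (Product C D) E → D.Obj → Functor C E
  appʳ T Y .F₀ X = F₀ T (X , Y)
  appʳ T Y .F₁ f = F₁ T (f , D.id)
  appʳ T Y .identity     = identity T
  appʳ T Y .homomorphism = E.Equiv.trans
    (F-resp-≈ T (C.Equiv.refl , D.Equiv.sym D.identityˡ)) (homomorphism T)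
  appʳ T Y .F-resp-≈ p   = F-resp-≈ T (p , D.Equiv.refl)

FullyFaithful : {C : Category o ℓ} {D : Category o′ ℓ′} → Functor C D → Set (o ⊔ ℓ ⊔ ℓ′)
FullyFaithful {C = C} {D} F =
  ∀ X Y → Bijective (Category._≈_ C {X} {Y}) (Category._≈_ D) (F₁ F)

module _ {C : Category o ℓ} {D : Category o′ ℓ′} where
  private
    module C = Category C
    module D = Category D

  record NaturalTransformation (F G : Functor C D) : Set (o ⊔ ℓ ⊔ ℓ′) where
    no-eta-equality
    field
      η       : ∀ X → D [ F₀ F X , F₀ G X ]
      commute : ∀ {X Y} (f : C [ X , Y ]) → D [ D [ η Y ∘ F₁ F f ] ≈ D [ F₁ G f ∘ η X ] ]

  record NaturalIsomorphism (F G : Functor C D) : Set (o ⊔ ℓ ⊔ ℓ′) where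
    field
      iso     : ∀ X → Iso D (F₀ F X) (F₀ G X)
      commute : ∀ {X Y} (f : C [ X , Y ]) →
                D [ D [ Iso.to (iso Y) ∘ F₁ F f ] ≈ D [ F₁ G f ∘ Iso.to (iso X) ] ]

    to : ∀ X → D [ F₀ F X , F₀ G X ]
    to X = Iso.to (iso X)

open NaturalTransformation public using (η)
open NaturalTransformation using () renaming (commute to natural)

module _ {C : Category o ℓ} {D : Category o′ ℓ′} where
  open Category D
  open HomReasoning

  idN : {F : Functor C D} → NaturalTransformation F F
  idN .η _       = id
  idN .natural _ = Equiv.trans identityˡ (Equiv.sym identityʳ)

  infixr 9 _∘N_
  _∘N_ : {F G H : Functor C D} → NaturalTransformation G H →
         NaturalTransformation F G → NaturalTransformation F H
  (β ∘N α) .η X = η β X ∘ η α X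
  _∘N_ {F} {G} {H} β α .natural {X} {Y} f = begin
    (η β Y ∘ η α Y) ∘ F₁ F f  ≈⟨ assoc ⟩
    η β Y ∘ (η α Y ∘ F₁ F f)  ≈⟨ ∘-resp-≈ʳ (natural α f) ⟩
    η β Y ∘ (F₁ G f ∘ η α X)  ≈⟨ assoc ⟨
    (η β Y ∘ F₁ G f) ∘ η α X  ≈⟨ ∘-resp-≈ˡ (natural β f) ⟩
    (F₁ H f ∘ η β X) ∘ η α X  ≈⟨ assoc ⟩
    F₁ H f ∘ (η β X ∘ η α X)  ∎

Functors : Category ℓ ℓ → Category o ℓ → Category (o ⊔ ℓ) ℓ
Functors V C = record
  { Obj       = Functor V C
  ; _⇒_       = NaturalTransformation
  ; _≈_       = λ α β → ∀ v → η α v ≈ η β v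
  ; id        = idN
  ; _∘_       = _∘N_
  ; assoc     = λ _ → assoc
  ; identityˡ = λ _ → identityˡ
  ; identityʳ = λ _ → identityʳ
  ; equiv     = record
    { refl  = λ _ → Equiv.refl
    ; sym   = λ p v → Equiv.sym (p v)
    ; trans = λ p q v → Equiv.trans (p v) (q v)
    }
  ; ∘-resp-≈  = λ p q v → ∘-resp-≈ (p v) (q v)
  }
  where open Category C

Presheaves : Category ℓ ℓ → Category (lsuc ℓ) ℓ
Presheaves {ℓ} V = Functors (Op V) (Setoids ℓ)

module _ {V : Category ℓ ℓ} {D : Category o ℓ} {E : Category o′ ℓ}
         (T : Functor (Product V D) E) where
  private
    module V = Category V
    module D = Category D
    module E = Category E

  private
    onArrow : ∀ {Y Z} → D [ Y , Z ] → NaturalTransformation (appʳ T Y) (appʳ T Z)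
    onArrow g .η v       = F₁ T (V.id , g)
    onArrow g .natural f = E.Equiv.trans (E.Equiv.sym (homomorphism T)) (E.Equiv.trans
      (F-resp-≈ T ( V.Equiv.trans V.identityˡ (V.Equiv.sym V.identityʳ)
                  , D.Equiv.trans D.identityʳ (D.Equiv.sym D.identityˡ)))
      (homomorphism T))

  -- Y ↦ T(− , Y)
  curryʳ : Functor D (Functors V E)
  curryʳ .F₀ = appʳ T
  curryʳ .F₁ = onArrow
  curryʳ .identity _     = identity T
  curryʳ .homomorphism v = homomorphism (appˡ T v)
  curryʳ .F-resp-≈ p _   = F-resp-≈ T (V.Equiv.refl , p)

module _ (C : Category o ℓ) where
  open Category C
  open HomReasoning

  Hom : Functor (Product (Op C) C) (Setoids ℓ)
  Hom .F₀ (A , B) = hom A B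
  Hom .F₁ (f , g) = record
    { to   = λ h → g ∘ (h ∘ f)
    ; cong = λ p → ∘-resp-≈ʳ (∘-resp-≈ˡ p)
    }
  Hom .identity h = Equiv.trans identityˡ identityʳ
  Hom .homomorphism {f = f , g} {g = f′ , g′} h = begin
    (g′ ∘ g) ∘ (h ∘ (f ∘ f′))    ≈⟨ assoc ⟩
    g′ ∘ (g ∘ (h ∘ (f ∘ f′)))    ≈⟨ ∘-resp-≈ʳ (∘-resp-≈ʳ assoc) ⟨
    g′ ∘ (g ∘ ((h ∘ f) ∘ f′))    ≈⟨ ∘-resp-≈ʳ assoc ⟨
    g′ ∘ ((g ∘ (h ∘ f)) ∘ f′)    ∎
  Hom .F-resp-≈ (p , q) h = ∘-resp-≈ q (∘-resp-≈ʳ p)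

module _ (V : Category ℓ ℓ) (A : Category o ℓ) where
  open Category A
  open HomReasoning

  private
    onArrows : ∀ {F G : Functor V A} {X Y} → NaturalTransformation G F → X ⇒ Y →
               NaturalTransformation (appʳ (Hom A) X ∘F opF F) (appʳ (Hom A) Y ∘F opF G)
    onArrows α f .η v = F₁ (Hom A) (η α v , f)
    onArrows {F} {G} α f .natural {v} {w} k h = begin
      f ∘ ((id ∘ (h ∘ F₁ F k)) ∘ η α w)  ≈⟨ ∘-resp-≈ʳ (∘-resp-≈ˡ identityˡ) ⟩
      f ∘ ((h ∘ F₁ F k) ∘ η α w)         ≈⟨ ∘-resp-≈ʳ assoc ⟩
      f ∘ (h ∘ (F₁ F k ∘ η α w))         ≈⟨ ∘-resp-≈ʳ (∘-resp-≈ʳ (natural α k)) ⟨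
      f ∘ (h ∘ (η α v ∘ F₁ G k))         ≈⟨ ∘-resp-≈ʳ assoc ⟨
      f ∘ ((h ∘ η α v) ∘ F₁ G k)         ≈⟨ assoc ⟨
      (f ∘ (h ∘ η α v)) ∘ F₁ G k         ≈⟨ identityˡ ⟨
      id ∘ ((f ∘ (h ∘ η α v)) ∘ F₁ G k)  ∎

  -- (F , X) ↦ A(F(−) , X)
  HomAlong : Functor (Product (Op (Functors V A)) A) (Presheaves V)
  HomAlong .F₀ (F , X) = appʳ (Hom A) X ∘F opF F
  HomAlong .F₁ (α , f) = onArrows α f
  HomAlong .identity _         = identity (Hom A)
  HomAlong .homomorphism {f = α , f} {g = β , g} v =
    homomorphism (Hom A) {f = η α v , f} {g = η β v , g}
  HomAlong .F-resp-≈ {f = α , f} {g = β , g} (p , q) v =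
    F-resp-≈ (Hom A) {f = η α v , f} {g = η β v , g} (p v , q)

nerve : {V : Category ℓ ℓ} {A : Category o ℓ} → Functor V A → Functor A (Presheaves V)
nerve {V = V} {A} J = appˡ (HomAlong V A) J

Dense : {V : Category ℓ ℓ} {A : Category o ℓ} → Functor V A → Set (o ⊔ ℓ)
Dense J = FullyFaithful (nerve J)

module _ {S : Category ℓ ℓ} {C : Category o ℓ} (F : Functor S C) where
  open Category C

  record Cocone : Set (o ⊔ ℓ) where
    no-eta-equality
    field
      N       : Obj
      ψ       : ∀ s → F₀ F s ⇒ N
      commute : ∀ {s t} (f : S [ s , t ]) → ψ t ∘ F₁ F f ≈ ψ s

  record Colimit : Set (o ⊔ ℓ) where
    no-eta-equality
    field
      cocone : Cocone
    open Cocone cocone public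
    field
      rep     : (K : Cocone) → N ⇒ Cocone.N K
      rep-ψ   : (K : Cocone) → ∀ s → rep K ∘ ψ s ≈ Cocone.ψ K s
      unique  : (K : Cocone) {u : N ⇒ Cocone.N K} →
                (∀ s → u ∘ ψ s ≈ Cocone.ψ K s) → rep K ≈ u

    jointly-epic : ∀ {X} {u v : N ⇒ X} → (∀ s → u ∘ ψ s ≈ v ∘ ψ s) → u ≈ v
    jointly-epic {X} {u} {v} p =
      Equiv.trans (Equiv.sym (unique K p)) (unique K (λ _ → Equiv.refl))
      where
      K : Cocone
      K .Cocone.N         = X
      K .Cocone.ψ s       = v ∘ ψ s
      K .Cocone.commute f = Equiv.trans assoc (∘-resp-≈ʳ (commute f))

record Cocomplete (C : Category o ℓ) : Set (o ⊔ lsuc ℓ) where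
  field
    colimit : {S : Category ℓ ℓ} (F : Functor S C) → Colimit F

-- The colimit of F is the disjoint union of the F s modulo the equivalence
-- relation generated by (s , x) ∼ (t , F f x).
module _ {S : Category ℓ ℓ} (F : Functor S (Setoids ℓ)) where
  private
    module S = Category S
    module F₀ (s : S.Obj) = Setoid (F₀ F s)
    Total : Set ℓ
    Total = Σ[ s ∈ S.Obj ] F₀.Carrier s

  infix 4 _∼_
  data _∼_ : Total → Total → Set ℓ where
    ∼-≈     : ∀ {s x y} → F₀._≈_ s x y → (s , x) ∼ (s , y)
    ∼-arrow : ∀ {s t} (f : S [ s , t ]) x → (s , x) ∼ (t , F₁ F f ⟨$⟩ x)
    ∼-sym   : ∀ {p q} → p ∼ q → q ∼ p
    ∼-trans : ∀ {p q r} → p ∼ q → q ∼ r → p ∼ r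

  Setoids-colimit : Colimit F
  Setoids-colimit = record
    { cocone = record
      { N       = record
        { Carrier = Total
        ; _≈_ = _∼_
        ; isEquivalence = record
          { refl = λ {(s , _)} → ∼-≈ (F₀.refl s) ; sym = ∼-sym ; trans = ∼-trans }
        }
      ; ψ       = λ s → record { to = λ x → s , x ; cong = ∼-≈ }
      ; commute = λ f x → ∼-sym (∼-arrow f x)
      }
    ; rep    = λ K → record { to = copair K ; cong = copair-cong K }
    ; rep-ψ  = λ K s x → Setoid.refl (Cocone.N K)
    ; unique = λ K p (s , x) → Setoid.sym (Cocone.N K) (p s x)
    }
    where
    copair : (K : Cocone F) → Total → Setoid.Carrier (Cocone.N K)
    copair K (s , x) = Cocone.ψ K s ⟨$⟩ x

    copair-cong : (K : Cocone F) → ∀ {p q} → p ∼ q →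
                  Setoid._≈_ (Cocone.N K) (copair K p) (copair K q)
    copair-cong K (∼-≈ {s} p)   = Func.cong (Cocone.ψ K s) p
    copair-cong K (∼-arrow f x) = Setoid.sym (Cocone.N K) (Cocone.commute K f x)
    copair-cong K (∼-sym p)     = Setoid.sym (Cocone.N K) (copair-cong K p)
    copair-cong K (∼-trans p q) =
      Setoid.trans (Cocone.N K) (copair-cong K p) (copair-cong K q)

-- Opaque because only the universal property of these colimits matters.
opaque
  Setoids-cocomplete : ∀ ℓ → Cocomplete (Setoids ℓ)
  Setoids-cocomplete ℓ = record { colimit = Setoids-colimit }

Discrete : Setoid ℓ ℓ → Category ℓ ℓ
Discrete S = record
  { Obj       = Carrier
  ; _⇒_       = _≈_
  ; _≈_       = λ _ _ → ⊤
  ; id        = refl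
  ; _∘_       = λ p q → trans q p
  ; assoc     = tt
  ; identityˡ = tt
  ; identityʳ = tt
  ; equiv     = record { refl = tt ; sym = λ _ → tt ; trans = λ _ _ → tt }
  ; ∘-resp-≈  = λ _ _ → tt
  }
  where open Setoid S

-- (f , v , w) ↦ (w , v) is the diagram Tw(V)ᵒᵖ → Vᵒᵖ × V whose colimits are coends.
module _ (V : Category ℓ ℓ) where
  open Category V

  TwistedArrows : Category ℓ ℓ
  TwistedArrows = record
    { Obj = Σ[ v ∈ Obj ] Σ[ w ∈ Obj ] v ⇒ w
    ; _⇒_ = λ (v , w , f) (v′ , w′ , f′) →
              Σ[ p ∈ v ⇒ v′ ] Σ[ q ∈ w′ ⇒ w ] q ∘ (f′ ∘ p) ≈ f
    ; _≈_ = λ (p , q , _) (p′ , q′ , _) → p ≈ p′ × q ≈ q′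
    ; id  = id , id , Equiv.trans identityˡ identityʳ
    ; _∘_ = λ { {_ , _ , f} {_ , _ , f′} {_ , _ , f″} (p′ , q′ , e′) (p , q , e) →
              p′ ∘ p , q ∘ q′ , (begin
                (q ∘ q′) ∘ (f″ ∘ (p′ ∘ p))  ≈⟨ assoc ⟩
                q ∘ (q′ ∘ (f″ ∘ (p′ ∘ p)))  ≈⟨ ∘-resp-≈ʳ (∘-resp-≈ʳ assoc) ⟨
                q ∘ (q′ ∘ ((f″ ∘ p′) ∘ p))  ≈⟨ ∘-resp-≈ʳ assoc ⟨
                q ∘ ((q′ ∘ (f″ ∘ p′)) ∘ p)  ≈⟨ ∘-resp-≈ʳ (∘-resp-≈ˡ e′) ⟩
                q ∘ (f′ ∘ p)                ≈⟨ e ⟩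
                f                           ∎) }
    ; assoc     = assoc , Equiv.sym assoc
    ; identityˡ = identityˡ , identityʳ
    ; identityʳ = identityʳ , identityˡ
    ; equiv     = record
      { refl  = Equiv.refl , Equiv.refl
      ; sym   = λ (p , q) → Equiv.sym p , Equiv.sym q
      ; trans = λ (p , q) (p′ , q′) → Equiv.trans p p′ , Equiv.trans q q′
      }
    ; ∘-resp-≈  = λ (p , q) (p′ , q′) → ∘-resp-≈ p p′ , ∘-resp-≈ q′ q
    }
    where open HomReasoning

  endpoints : Functor TwistedArrows (Product (Op V) V)
  endpoints .F₀ (v , w , _)   = w , v
  endpoints .F₁ (p , q , _)   = q , p
  endpoints .identity         = Equiv.refl , Equiv.refl
  endpoints .homomorphism     = Equiv.refl , Equiv.refl
  endpoints .F-resp-≈ (p , q) = q , p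

module _ (V : Category ℓ ℓ) {C : Category o ℓ} (H : Functor (Product (Op V) V) C) where
  open Category C
  private module V = Category V

  record Cowedge : Set (o ⊔ ℓ) where
    no-eta-equality
    field
      E          : Obj
      ι          : ∀ v → F₀ H (v , v) ⇒ E
      dinatural  : ∀ {v w} (f : V [ v , w ]) →
                   ι v ∘ F₁ H (f , V.id) ≈ ι w ∘ F₁ H (V.id , f)

  record Coend : Set (o ⊔ ℓ) where
    no-eta-equality
    field
      cowedge : Cowedge
    open Cowedge cowedge public
    field
      factor   : (K : Cowedge) → E ⇒ Cowedge.E K
      factor-ι : (K : Cowedge) → ∀ v → factor K ∘ ι v ≈ Cowedge.ι K v
      unique   : (K : Cowedge) {u : E ⇒ Cowedge.E K} →
                 (∀ v → u ∘ ι v ≈ Cowedge.ι K v) → factor K ≈ u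

    jointly-epic : ∀ {X} {u v : E ⇒ X} → (∀ a → u ∘ ι a ≈ v ∘ ι a) → u ≈ v
    jointly-epic {X} {u} {v} p =
      Equiv.trans (Equiv.sym (unique K p)) (unique K (λ _ → Equiv.refl))
      where
      K : Cowedge
      K .Cowedge.E           = X
      K .Cowedge.ι a         = v ∘ ι a
      K .Cowedge.dinatural f = Equiv.trans assoc
        (Equiv.trans (∘-resp-≈ʳ (dinatural f)) (Equiv.sym assoc))

module _ (V : Category ℓ ℓ) {C : Category o ℓ}
         (coend : (H : Functor (Product (Op V) V) C) → Coend V H) where
  open Category C
  open HomReasoning
  private
    module V = Category V
    module ∫ (H : Functor (Product (Op V) V) C) = Coend (coend H)

    wedge : ∀ H H′ → NaturalTransformation H H′ → Cowedge V H
    wedge H H′ α .Cowedge.E   = ∫.E H′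
    wedge H H′ α .Cowedge.ι v = ∫.ι H′ v ∘ η α (v , v)
    wedge H H′ α .Cowedge.dinatural {v} {w} f = begin
      (∫.ι H′ v ∘ η α (v , v)) ∘ F₁ H (f , V.id)   ≈⟨ assoc ⟩
      ∫.ι H′ v ∘ (η α (v , v) ∘ F₁ H (f , V.id))   ≈⟨ ∘-resp-≈ʳ (natural α (f , V.id)) ⟩
      ∫.ι H′ v ∘ (F₁ H′ (f , V.id) ∘ η α (w , v))  ≈⟨ assoc ⟨
      (∫.ι H′ v ∘ F₁ H′ (f , V.id)) ∘ η α (w , v)  ≈⟨ ∘-resp-≈ˡ (∫.dinatural H′ f) ⟩
      (∫.ι H′ w ∘ F₁ H′ (V.id , f)) ∘ η α (w , v)  ≈⟨ assoc ⟩
      ∫.ι H′ w ∘ (F₁ H′ (V.id , f) ∘ η α (w , v))  ≈⟨ ∘-resp-≈ʳ (natural α (V.id , f)) ⟨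
      ∫.ι H′ w ∘ (η α (w , w) ∘ F₁ H (V.id , f))   ≈⟨ assoc ⟨
      (∫.ι H′ w ∘ η α (w , w)) ∘ F₁ H (V.id , f)   ∎

    map : ∀ H H′ → NaturalTransformation H H′ → ∫.E H ⇒ ∫.E H′
    map H H′ α = ∫.factor H (wedge H H′ α)

    map-ι : ∀ H H′ (α : NaturalTransformation H H′) v →
            map H H′ α ∘ ∫.ι H v ≈ ∫.ι H′ v ∘ η α (v , v)
    map-ι H H′ α = ∫.factor-ι H (wedge H H′ α)

  Coends : Functor (Functors (Product (Op V) V) C) C
  Coends .F₀ = ∫.E
  Coends .F₁ {H} {H′} α = map H H′ α
  Coends .identity {H} = ∫.jointly-epic H λ v → begin
    map H H idN ∘ ∫.ι H v  ≈⟨ map-ι H H idN v ⟩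
    ∫.ι H v ∘ id           ≈⟨ identityʳ ⟩
    ∫.ι H v                ≈⟨ identityˡ ⟨
    id ∘ ∫.ι H v           ∎
  Coends .homomorphism {H} {H′} {H″} {α} {β} = ∫.jointly-epic H λ v → begin
    map H H″ (β ∘N α) ∘ ∫.ι H v             ≈⟨ map-ι H H″ (β ∘N α) v ⟩
    ∫.ι H″ v ∘ (η β (v , v) ∘ η α (v , v))  ≈⟨ assoc ⟨
    (∫.ι H″ v ∘ η β (v , v)) ∘ η α (v , v)  ≈⟨ ∘-resp-≈ˡ (map-ι H′ H″ β v) ⟨
    (map H′ H″ β ∘ ∫.ι H′ v) ∘ η α (v , v)  ≈⟨ assoc ⟩
    map H′ H″ β ∘ (∫.ι H′ v ∘ η α (v , v))  ≈⟨ ∘-resp-≈ʳ (map-ι H H′ α v) ⟨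
    map H′ H″ β ∘ (map H H′ α ∘ ∫.ι H v)    ≈⟨ assoc ⟨
    (map H′ H″ β ∘ map H H′ α) ∘ ∫.ι H v    ∎
  Coends .F-resp-≈ {H} {H′} {α} {β} p = ∫.jointly-epic H λ v → begin
    map H H′ α ∘ ∫.ι H v    ≈⟨ map-ι H H′ α v ⟩
    ∫.ι H′ v ∘ η α (v , v)  ≈⟨ ∘-resp-≈ʳ (p (v , v)) ⟩
    ∫.ι H′ v ∘ η β (v , v)  ≈⟨ map-ι H H′ β v ⟨
    map H H′ β ∘ ∫.ι H v    ∎

module Colimits {C : Category o ℓ} (colim : Cocomplete C) where
  open Category C
  open HomReasoning

  -- The coproduct of S-many copies of X; its injections respect the equality of S.
  copower : (S : Setoid ℓ ℓ) (X : Obj) → Colimit (constF {C = Discrete S} {D = C} X)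
  copower S X = Cocomplete.colimit colim (constF X)

  infixr 7 _·_
  _·_ : Setoid ℓ ℓ → Obj → Obj
  S · X = Colimit.N (copower S X)

  module _ (S : Setoid ℓ ℓ) (X : Obj) where
    private module S = Setoid S

    inj : S.Carrier → X ⇒ S · X
    inj s = Colimit.ψ (copower S X) s

    inj-cong : ∀ {s t} → s S.≈ t → inj s ≈ inj t
    inj-cong p = Equiv.sym
      (Equiv.trans (Equiv.sym identityʳ) (Colimit.commute (copower S X) p))

    private
      cocone : ∀ {Y} → Func S (hom X Y) → Cocone (constF {C = Discrete S} {D = C} X)
      cocone {Y} k .Cocone.N     = Y
      cocone k .Cocone.ψ s       = k ⟨$⟩ s
      cocone k .Cocone.commute p = Equiv.trans identityʳ (Func.cong k (S.sym p))

    copair : ∀ {Y} → Func S (hom X Y) → S · X ⇒ Y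
    copair k = Colimit.rep (copower S X) (cocone k)

    copair-inj : ∀ {Y} (k : Func S (hom X Y)) s → copair k ∘ inj s ≈ k ⟨$⟩ s
    copair-inj k = Colimit.rep-ψ (copower S X) (cocone k)

    inj-epic : ∀ {Y} {u v : S · X ⇒ Y} → (∀ s → u ∘ inj s ≈ v ∘ inj s) → u ≈ v
    inj-epic = Colimit.jointly-epic (copower S X)

  module _ (S T : Setoid ℓ ℓ) (X Y : Obj) where
    private
      legs : Func S T → X ⇒ Y → Func S (hom X (T · Y))
      legs g h = record
        { to   = λ s → inj T Y (g ⟨$⟩ s) ∘ h
        ; cong = λ p → ∘-resp-≈ˡ (inj-cong T Y (Func.cong g p))
        }

    copower₁ : Func S T → X ⇒ Y → S · X ⇒ T · Y
    copower₁ g h = copair S X (legs g h)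

    copower₁-inj : ∀ g h s → copower₁ g h ∘ inj S X s ≈ inj T Y (g ⟨$⟩ s) ∘ h
    copower₁-inj g h = copair-inj S X (legs g h)

  Copower : Functor (Product (Setoids ℓ) C) C
  Copower .F₀ (S , X) = S · X
  Copower .F₁ {S , X} {T , Y} (g , h) = copower₁ S T X Y g h
  Copower .identity {S , X} = inj-epic S X λ s → begin
    copower₁ S S X X idS id ∘ inj S X s  ≈⟨ copower₁-inj S S X X idS id s ⟩
    inj S X s ∘ id                       ≈⟨ identityʳ ⟩
    inj S X s                            ≈⟨ identityˡ ⟨
    id ∘ inj S X s                       ∎
    where idS = Category.id (Setoids ℓ)
  Copower .homomorphism {S , X} {T , Y} {U , Z} {g , h} {g′ , h′} = inj-epic S X λ s → begin
    copower₁ S U X Z (Setoids ℓ [ g′ ∘ g ]) (h′ ∘ h) ∘ inj S X s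
      ≈⟨ copower₁-inj S U X Z (Setoids ℓ [ g′ ∘ g ]) (h′ ∘ h) s ⟩
    inj U Z (g′ ⟨$⟩ (g ⟨$⟩ s)) ∘ (h′ ∘ h)
      ≈⟨ assoc ⟨
    (inj U Z (g′ ⟨$⟩ (g ⟨$⟩ s)) ∘ h′) ∘ h
      ≈⟨ ∘-resp-≈ˡ (copower₁-inj T U Y Z g′ h′ (g ⟨$⟩ s)) ⟨
    (copower₁ T U Y Z g′ h′ ∘ inj T Y (g ⟨$⟩ s)) ∘ h
      ≈⟨ assoc ⟩
    copower₁ T U Y Z g′ h′ ∘ (inj T Y (g ⟨$⟩ s) ∘ h)
      ≈⟨ ∘-resp-≈ʳ (copower₁-inj S T X Y g h s) ⟨
    copower₁ T U Y Z g′ h′ ∘ (copower₁ S T X Y g h ∘ inj S X s)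
      ≈⟨ assoc ⟨
    (copower₁ T U Y Z g′ h′ ∘ copower₁ S T X Y g h) ∘ inj S X s
      ∎
  Copower .F-resp-≈ {S , X} {T , Y} {g , h} {g′ , h′} (p , q) = inj-epic S X λ s → begin
    copower₁ S T X Y g h ∘ inj S X s    ≈⟨ copower₁-inj S T X Y g h s ⟩
    inj T Y (g ⟨$⟩ s) ∘ h               ≈⟨ ∘-resp-≈ (inj-cong T Y (p s)) q ⟩
    inj T Y (g′ ⟨$⟩ s) ∘ h′             ≈⟨ copower₁-inj S T X Y g′ h′ s ⟨
    copower₁ S T X Y g′ h′ ∘ inj S X s  ∎

  module _ (V : Category ℓ ℓ) where
    private module V = Category V

    private
      module _ (H : Functor (Product (Op V) V) C) where
        module L = Colimit (Cocomplete.colimit colim (H ∘F endpoints V))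

        wedge : Cowedge V H
        wedge .Cowedge.E   = L.N
        wedge .Cowedge.ι v = L.ψ (v , v , V.id)
        wedge .Cowedge.dinatural f = Equiv.trans
          (L.commute (V.id , f , V.Equiv.trans (V.∘-resp-≈ʳ V.identityˡ) V.identityʳ))
          (Equiv.sym (L.commute (f , V.id , V.Equiv.trans V.identityˡ V.identityˡ)))

        cone : Cowedge V H → Cocone (H ∘F endpoints V)
        cone K .Cocone.N             = Cowedge.E K
        cone K .Cocone.ψ (v , w , f) = Cowedge.ι K v ∘ F₁ H (f , V.id)
        cone K .Cocone.commute {v , w , f} {v′ , w′ , f′} (p , q , e) = begin
          (ι v′ ∘ F₁ H (f′ , V.id)) ∘ F₁ H (q , p)
            ≈⟨ assoc ⟩
          ι v′ ∘ (F₁ H (f′ , V.id) ∘ F₁ H (q , p))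
            ≈⟨ ∘-resp-≈ʳ (homomorphism H) ⟨
          ι v′ ∘ F₁ H (q V.∘ f′ , V.id V.∘ p)
            ≈⟨ ∘-resp-≈ʳ (F-resp-≈ H ( V.Equiv.sym V.identityʳ
                                     , V.Equiv.trans V.identityˡ (V.Equiv.sym V.identityʳ))) ⟩
          ι v′ ∘ F₁ H ((q V.∘ f′) V.∘ V.id , p V.∘ V.id)
            ≈⟨ ∘-resp-≈ʳ (homomorphism H) ⟩
          ι v′ ∘ (F₁ H (V.id , p) ∘ F₁ H (q V.∘ f′ , V.id))
            ≈⟨ assoc ⟨
          (ι v′ ∘ F₁ H (V.id , p)) ∘ F₁ H (q V.∘ f′ , V.id)
            ≈⟨ ∘-resp-≈ˡ (dinatural p) ⟨
          (ι v ∘ F₁ H (p , V.id)) ∘ F₁ H (q V.∘ f′ , V.id)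
            ≈⟨ assoc ⟩
          ι v ∘ (F₁ H (p , V.id) ∘ F₁ H (q V.∘ f′ , V.id))
            ≈⟨ ∘-resp-≈ʳ (homomorphism H) ⟨
          ι v ∘ F₁ H ((q V.∘ f′) V.∘ p , V.id V.∘ V.id)
            ≈⟨ ∘-resp-≈ʳ (F-resp-≈ H (V.Equiv.trans V.assoc e , V.identityˡ)) ⟩
          ι v ∘ F₁ H (f , V.id)
            ∎
          where open Cowedge K using (ι; dinatural)

    coend : (H : Functor (Product (Op V) V) C) → Coend V H
    coend H .Coend.cowedge      = wedge H
    coend H .Coend.factor K     = L.rep H (cone H K)
    coend H .Coend.factor-ι K v = Equiv.trans (L.rep-ψ H (cone H K) (v , v , V.id))
      (Equiv.trans (∘-resp-≈ʳ (identity H)) identityʳ)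
    coend H .Coend.unique K {u} p = L.unique H (cone H K) λ (v , w , f) → begin
      u ∘ L.ψ H (v , w , f)
        ≈⟨ ∘-resp-≈ʳ (L.commute H
             (V.id , f , V.Equiv.trans (V.∘-resp-≈ʳ V.identityˡ) V.identityʳ)) ⟨
      u ∘ (L.ψ H (v , v , V.id) ∘ F₁ H (f , V.id))
        ≈⟨ assoc ⟨
      (u ∘ L.ψ H (v , v , V.id)) ∘ F₁ H (f , V.id)
        ≈⟨ ∘-resp-≈ˡ (p v) ⟩
      Cowedge.ι K v ∘ F₁ H (f , V.id)
        ∎

    private
      onArrows : ∀ {X Y : Functor (Op V) (Setoids ℓ)} {F G : Functor V C} →
                 NaturalTransformation X Y → NaturalTransformation F G →
                 NaturalTransformation (Copower ∘F (X ⁂ F)) (Copower ∘F (Y ⁂ G))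
      onArrows α β .η (v , w) = F₁ Copower (η α v , η β w)
      onArrows {X} {Y} {F} {G} α β .natural {v , w} {v′ , w′} (f , g) = begin
        F₁ Copower (η α v′ , η β w′) ∘ F₁ Copower (F₁ X f , F₁ F g)
          ≈⟨ homomorphism Copower {f = F₁ X f , F₁ F g} {g = η α v′ , η β w′} ⟨
        F₁ Copower (Setoids ℓ [ η α v′ ∘ F₁ X f ] , η β w′ ∘ F₁ F g)
          ≈⟨ F-resp-≈ Copower {f = Setoids ℓ [ η α v′ ∘ F₁ X f ] , η β w′ ∘ F₁ F g}
                              {g = Setoids ℓ [ F₁ Y f ∘ η α v ] , F₁ G g ∘ η β w}
                              (natural α f , natural β g) ⟩
        F₁ Copower (Setoids ℓ [ F₁ Y f ∘ η α v ] , F₁ G g ∘ η β w)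
          ≈⟨ homomorphism Copower {f = η α v , η β w} {g = F₁ Y f , F₁ G g} ⟩
        F₁ Copower (F₁ Y f , F₁ G g) ∘ F₁ Copower (η α v , η β w)
          ∎

    -- (X , F) ↦ X(−) · F(=)
    Copowers : Functor (Product (Presheaves V) (Functors V C)) (Functors (Product (Op V) V) C)
    Copowers .F₀ (X , F) = Copower ∘F (X ⁂ F)
    Copowers .F₁ (α , β) = onArrows α β
    Copowers .identity {X , F} (v , w) = identity Copower {F₀ X v , F₀ F w}
    Copowers .homomorphism {f = α , β} {g = α′ , β′} (v , w) =
      homomorphism Copower {f = η α v , η β w} {g = η α′ v , η β′ w}
    Copowers .F-resp-≈ {f = α , β} {g = α′ , β′} (p , q) (v , w) =
      F-resp-≈ Copower {f = η α v , η β w} {g = η α′ v , η β′ w} (p v , q w)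

    -- (X , F) ↦ ∫^V X V · F V
    CoendCopower : Functor (Product (Presheaves V) (Functors V C)) C
    CoendCopower = Coends V coend ∘F Copowers

    module _ (X : Functor (Op V) (Setoids ℓ)) (F : Functor V C) where
      private
        module X = Functor X
        module F = Functor F
        module ∫ = Coend (coend (F₀ Copowers (X , F)))

      -- The coprojection of F v at x ∈ X v into ∫^V X V · F V.
      coproj : ∀ v → Setoid.Carrier (X.F₀ v) → F.F₀ v ⇒ F₀ CoendCopower (X , F)
      coproj v x = ∫.ι v ∘ inj (X.F₀ v) (F.F₀ v) x

      coprojs : ∀ v → Func (X.F₀ v) (hom (F.F₀ v) (F₀ CoendCopower (X , F)))
      coprojs v = record
        { to = coproj v ; cong = λ p → ∘-resp-≈ʳ (inj-cong (X.F₀ v) (F.F₀ v) p) }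

      coproj-dinatural : ∀ {v w} (f : V [ v , w ]) x →
                         coproj v (X.F₁ f ⟨$⟩ x) ≈ coproj w x ∘ F.F₁ f
      coproj-dinatural {v} {w} f x = begin
        ∫.ι v ∘ inj (X.F₀ v) (F.F₀ v) (X.F₁ f ⟨$⟩ x)
          ≈⟨ ∘-resp-≈ʳ identityʳ ⟨
        ∫.ι v ∘ (inj (X.F₀ v) (F.F₀ v) (X.F₁ f ⟨$⟩ x) ∘ id)
          ≈⟨ ∘-resp-≈ʳ (∘-resp-≈ʳ F.identity) ⟨
        ∫.ι v ∘ (inj (X.F₀ v) (F.F₀ v) (X.F₁ f ⟨$⟩ x) ∘ F.F₁ V.id)
          ≈⟨ ∘-resp-≈ʳ (copower₁-inj (X.F₀ w) (X.F₀ v) (F.F₀ v) (F.F₀ v) (X.F₁ f) (F.F₁ V.id) x) ⟨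
        ∫.ι v ∘ (F₁ Copower (X.F₁ f , F.F₁ V.id) ∘ inj (X.F₀ w) (F.F₀ v) x)
          ≈⟨ assoc ⟨
        (∫.ι v ∘ F₁ Copower (X.F₁ f , F.F₁ V.id)) ∘ inj (X.F₀ w) (F.F₀ v) x
          ≈⟨ ∘-resp-≈ˡ (∫.dinatural f) ⟩
        (∫.ι w ∘ F₁ Copower (X.F₁ V.id , F.F₁ f)) ∘ inj (X.F₀ w) (F.F₀ v) x
          ≈⟨ assoc ⟩
        ∫.ι w ∘ (F₁ Copower (X.F₁ V.id , F.F₁ f) ∘ inj (X.F₀ w) (F.F₀ v) x)
          ≈⟨ ∘-resp-≈ʳ (copower₁-inj (X.F₀ w) (X.F₀ w) (F.F₀ v) (F.F₀ w) (X.F₁ V.id) (F.F₁ f) x) ⟩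
        ∫.ι w ∘ (inj (X.F₀ w) (F.F₀ w) (X.F₁ V.id ⟨$⟩ x) ∘ F.F₁ f)
          ≈⟨ ∘-resp-≈ʳ (∘-resp-≈ˡ (inj-cong (X.F₀ w) (F.F₀ w) (X.identity x))) ⟩
        ∫.ι w ∘ (inj (X.F₀ w) (F.F₀ w) x ∘ F.F₁ f)
          ≈⟨ assoc ⟨
        (∫.ι w ∘ inj (X.F₀ w) (F.F₀ w) x) ∘ F.F₁ f
          ∎

    -- The left adjoint [Vᵒᵖ , Set] → C of the nerve of J.
    LanYoneda : Functor V C → Functor (Presheaves V) C
    LanYoneda J = appʳ CoendCopower J

    Lan : {A : Category o′ ℓ} (J : Functor V A) (F : Functor V C) → Functor A C
    Lan J F = appʳ CoendCopower F ∘F nerve J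

-- The canonical morphism  ∫^V X V · G(F V) → G(∫^V X V · F V).
module _ (V : Category ℓ ℓ) {C : Category o ℓ} {D : Category o′ ℓ}
         (colimC : Cocomplete C) (colimD : Cocomplete D)
         (G : Functor C D) (X : Functor (Op V) (Setoids ℓ)) (F : Functor V C) where
  private
    module V = Category V
    module G = Functor G
    module F = Functor F
    module X = Functor X
  open Category D
  open HomReasoning
  open Colimits

  private
    onHoms : ∀ Y Z → Func (Category.hom C Y Z) (hom (G.F₀ Y) (G.F₀ Z))
    onHoms Y Z = record { to = G.F₁ ; cong = G.F-resp-≈ }

    legs : ∀ v → Func (X.F₀ v) (hom (G.F₀ (F.F₀ v)) (G.F₀ (F₀ (CoendCopower colimC V) (X , F))))
    legs v = Composition.function (coprojs colimC V X F v)
      (onHoms (F.F₀ v) (F₀ (CoendCopower colimC V) (X , F)))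

    leg : ∀ v → F₀ (Copower colimD) (X.F₀ v , G.F₀ (F.F₀ v)) ⇒ G.F₀ (F₀ (CoendCopower colimC V) (X , F))
    leg v = copair colimD (X.F₀ v) (G.F₀ (F.F₀ v)) (legs v)

    leg-inj : ∀ v S Y (g : Func S (X.F₀ v)) (h : Y ⇒ G.F₀ (F.F₀ v)) s →
              (leg v ∘ F₁ (Copower colimD) (g , h)) ∘ inj colimD S Y s
              ≈ G.F₁ (coproj colimC V X F v (g ⟨$⟩ s)) ∘ h
    leg-inj v S Y g h s = begin
      (leg v ∘ F₁ (Copower colimD) (g , h)) ∘ inj colimD S Y s
        ≈⟨ assoc ⟩
      leg v ∘ (F₁ (Copower colimD) (g , h) ∘ inj colimD S Y s)
        ≈⟨ ∘-resp-≈ʳ (copower₁-inj colimD S (X.F₀ v) Y (G.F₀ (F.F₀ v)) g h s) ⟩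
      leg v ∘ (inj colimD (X.F₀ v) (G.F₀ (F.F₀ v)) (g ⟨$⟩ s) ∘ h)
        ≈⟨ assoc ⟨
      (leg v ∘ inj colimD (X.F₀ v) (G.F₀ (F.F₀ v)) (g ⟨$⟩ s)) ∘ h
        ≈⟨ ∘-resp-≈ˡ (copair-inj colimD (X.F₀ v) (G.F₀ (F.F₀ v)) (legs v) (g ⟨$⟩ s)) ⟩
      G.F₁ (coproj colimC V X F v (g ⟨$⟩ s)) ∘ h
        ∎

    wedge : Cowedge V (F₀ (Copowers colimD V) (X , G ∘F F))
    wedge .Cowedge.E = G.F₀ (F₀ (CoendCopower colimC V) (X , F))
    wedge .Cowedge.ι = leg
    wedge .Cowedge.dinatural {v} {w} f = inj-epic colimD (X.F₀ w) (G.F₀ (F.F₀ v)) λ x → begin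
      (leg v ∘ F₁ (Copower colimD) (X.F₁ f , G.F₁ (F.F₁ V.id))) ∘ inj colimD (X.F₀ w) (G.F₀ (F.F₀ v)) x
        ≈⟨ leg-inj v (X.F₀ w) (G.F₀ (F.F₀ v)) (X.F₁ f) (G.F₁ (F.F₁ V.id)) x ⟩
      G.F₁ (coproj colimC V X F v (X.F₁ f ⟨$⟩ x)) ∘ G.F₁ (F.F₁ V.id)
        ≈⟨ ∘-resp-≈ʳ (Equiv.trans (G.F-resp-≈ F.identity) G.identity) ⟩
      G.F₁ (coproj colimC V X F v (X.F₁ f ⟨$⟩ x)) ∘ id
        ≈⟨ identityʳ ⟩
      G.F₁ (coproj colimC V X F v (X.F₁ f ⟨$⟩ x))
        ≈⟨ G.F-resp-≈ (coproj-dinatural colimC V X F f x) ⟩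
      G.F₁ (C [ coproj colimC V X F w x ∘ F.F₁ f ])
        ≈⟨ G.homomorphism ⟩
      G.F₁ (coproj colimC V X F w x) ∘ G.F₁ (F.F₁ f)
        ≈⟨ ∘-resp-≈ˡ (Func.cong (legs w) (X.identity x)) ⟨
      G.F₁ (coproj colimC V X F w (X.F₁ V.id ⟨$⟩ x)) ∘ G.F₁ (F.F₁ f)
        ≈⟨ leg-inj w (X.F₀ w) (G.F₀ (F.F₀ v)) (X.F₁ V.id) (G.F₁ (F.F₁ f)) x ⟨
      (leg w ∘ F₁ (Copower colimD) (X.F₁ V.id , G.F₁ (F.F₁ f))) ∘ inj colimD (X.F₀ w) (G.F₀ (F.F₀ v)) x
        ∎

  comparison : F₀ (CoendCopower colimD V) (X , G ∘F F) ⇒ G.F₀ (F₀ (CoendCopower colimC V) (X , F))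
  comparison = Coend.factor (coend colimD V (F₀ (Copowers colimD V) (X , G ∘F F))) wedge

-- The canonical morphism  (Lan_J GF) X → G((Lan_J F) X), where
-- (Lan_J F) X = ∫^V A(J V , X) · F V.
lanComparison :
  {V : Category ℓ ℓ} {A : Category o ℓ} {C : Category o′ ℓ} {D : Category o″ ℓ}
  (colimC : Cocomplete C) (colimD : Cocomplete D)
  (J : Functor V A) (F : Functor V C) (G : Functor C D) (X : Category.Obj A) →
  D [ F₀ (Colimits.Lan colimD V J (G ∘F F)) X , F₀ G (F₀ (Colimits.Lan colimC V J F) X) ]
lanComparison {V = V} {C = C} {D} colimC colimD J F G X =
  comparison V {C = C} {D = D} colimC colimD G (F₀ (nerve J) X) F

-- In preserves, appˡ (Hom A) (F₀ J v) is the functor A(J v , −).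
record WellBehaved {V : Category ℓ ℓ} {A : Category o ℓ} (colim : Cocomplete A)
                   (J F : Functor V A) : Set (o ⊔ ℓ) where
  field
    fullyFaithful : FullyFaithful J
    dense         : Dense J
    preserves     : ∀ v X → IsIso (Setoids ℓ)
      (lanComparison {A = A} {C = A} {D = Setoids ℓ} colim (Setoids-cocomplete ℓ)
        J F (appˡ (Hom A) (F₀ J v)) X)

record Monoidal (V : Category o ℓ) : Set (o ⊔ ℓ) where
  open Category V
  field
    ⊗ : Functor (Product V V) V
    I : Obj
    λ-iso : NaturalIsomorphism (appˡ ⊗ I) idF
    ρ-iso : NaturalIsomorphism (appʳ ⊗ I) idF
    α-iso : NaturalIsomorphism (⊗ ∘F (idF ⁂ ⊗)) (⊗ ∘F ((⊗ ⁂ idF) ∘F assocF))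

  infixr 10 _⊗₀_ _⊗₁_
  _⊗₀_ : Obj → Obj → Obj
  X ⊗₀ Y = F₀ ⊗ (X , Y)
  _⊗₁_ : ∀ {X X′ Y Y′} → X ⇒ X′ → Y ⇒ Y′ → X ⊗₀ Y ⇒ X′ ⊗₀ Y′
  f ⊗₁ g = F₁ ⊗ (f , g)

  λ⇒ : ∀ X → I ⊗₀ X ⇒ X
  λ⇒ = NaturalIsomorphism.to λ-iso
  ρ⇒ : ∀ X → X ⊗₀ I ⇒ X
  ρ⇒ = NaturalIsomorphism.to ρ-iso
  α⇒ : ∀ X Y Z → X ⊗₀ (Y ⊗₀ Z) ⇒ (X ⊗₀ Y) ⊗₀ Z
  α⇒ X Y Z = NaturalIsomorphism.to α-iso (X , Y , Z)

  field
    pentagon : ∀ {W X Y Z} →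
      α⇒ (W ⊗₀ X) Y Z ∘ α⇒ W X (Y ⊗₀ Z)
      ≈ (α⇒ W X Y ⊗₁ id) ∘ (α⇒ W (X ⊗₀ Y) Z ∘ (id ⊗₁ α⇒ X Y Z))
    triangle : ∀ {X Y} → (ρ⇒ X ⊗₁ id) ∘ α⇒ X I Y ≈ id ⊗₁ λ⇒ Y

record Action {V : Category o ℓ} (M : Monoidal V) (A : Category o′ ℓ′)
              : Set (o ⊔ ℓ ⊔ o′ ⊔ ℓ′) where
  private module V = Category V
  open Monoidal M
  open Category A
  field
    ◁ : Functor (Product V A) A
    unitor     : NaturalIsomorphism (appˡ ◁ I) idF
    associator : NaturalIsomorphism (◁ ∘F (idF ⁂ ◁)) (◁ ∘F ((⊗ ⁂ idF) ∘F assocF))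

  infixr 10 _◁₀_ _◁₁_
  _◁₀_ : V.Obj → Obj → Obj
  v ◁₀ X = F₀ ◁ (v , X)
  _◁₁_ : ∀ {v v′ X X′} → V [ v , v′ ] → X ⇒ X′ → v ◁₀ X ⇒ v′ ◁₀ X′
  f ◁₁ g = F₁ ◁ (f , g)

  l⇒ : ∀ X → I ◁₀ X ⇒ X
  l⇒ = NaturalIsomorphism.to unitor
  m⇒ : ∀ v u X → v ◁₀ (u ◁₀ X) ⇒ (v ⊗₀ u) ◁₀ X
  m⇒ v u X = NaturalIsomorphism.to associator (v , u , X)

  field
    pentagon : ∀ {v u w X} →
      m⇒ (v ⊗₀ u) w X ∘ m⇒ v u (w ◁₀ X)
      ≈ (α⇒ v u w ◁₁ id) ∘ (m⇒ v (u ⊗₀ w) X ∘ (V.id ◁₁ m⇒ u w X))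
    triangle : ∀ {v X} → (ρ⇒ v ◁₁ id) ∘ m⇒ v I X ≈ V.id ◁₁ l⇒ X

-- T(− , B) ⊣ H(B , −) for every B:
-- Hom(T(A , B) , C) ≅ Hom(A , H(B , C)), naturally in A, B and C.
AdjunctionWithParameter : {A : Category o ℓ} {B : Category o′ ℓ} {C : Category o″ ℓ} →
  Functor (Product A B) C → Functor (Product (Op B) C) A → Set (o ⊔ o′ ⊔ o″ ⊔ ℓ)
AdjunctionWithParameter {A = A} {C = C} T H =
  NaturalIsomorphism (Hom C ∘F ((opF T ⁂ idF) ∘F assocF)) (Hom A ∘F (idF ⁂ H))

module Extension {V : Category ℓ ℓ} {M : Monoidal V} {A : Category o ℓ}
                 (colim : Cocomplete A) (act : Action M A) (Jᴵ : Category.Obj A) where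
  open Action act public using (◁)

  -- B ↦ (−) ◁ B
  ◁-curried : Functor A (Functors V A)
  ◁-curried = curryʳ ◁

  J : Functor V A
  J = F₀ ◁-curried Jᴵ

  -- A ◁_J B = ∫^V A(J V , A) · (V ◁ B)
  ◁ᴶ : Functor (Product A A) A
  ◁ᴶ = Colimits.CoendCopower colim V ∘F (nerve J ⁂ ◁-curried)

  -- (B , C) ↦ A((−) ◁ B , C)
  ◁-hom : Functor (Product (Op A) A) (Presheaves V)
  ◁-hom = HomAlong V A ∘F (opF ◁-curried ⁂ idF)

  [-,-]⋄ : Functor (Product (Op A) A) A
  [-,-]⋄ = Colimits.LanYoneda colim V J ∘F ◁-hom

module Submission where

open import Data.Product using (_,_; proj₁; proj₂)
open import Function.Bundles using (Func; _⟨$⟩_)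
open import Level using (Level)
open import Relation.Binary.Bundles using (Setoid)
open import Defs

-- Write ν for the nerve of J and X for the presheaf A((-) ◁ B , C).  The universal
-- property of coends gives A(A′ ◁ᴶ B , C) ≅ Nat(ν A′ , X), and density gives
-- Nat(ν A′ , ν (Lan X)) ≅ A(A′ , Lan X).  As ν is fully faithful, the monad ν Lan is
-- idempotent, so any isomorphism ν (Lan X) ≅ X, natural or not, forces the unit
-- X → ν (Lan X) to be invertible, and the unit is natural in B and C.

private
  variable
    o o′ ℓ : Level

-- Universal property of the coend of copowers.

module _ {V : Category ℓ ℓ} {C : Category o ℓ} (colim : Cocomplete C) where
  open Category C
  open HomReasoning
  open Colimits colim

  module _ (X : Functor (Op V) (Setoids ℓ)) (F : Functor V C) where
    private module V = Category V

    coproj-epic : ∀ {Y} {u w : F₀ (CoendCopower V) (X , F) ⇒ Y} →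
                  (∀ v x → u ∘ coproj V X F v x ≈ w ∘ coproj V X F v x) → u ≈ w
    coproj-epic p = Coend.jointly-epic (coend V (F₀ (Copowers V) (X , F))) λ v →
      inj-epic (F₀ X v) (F₀ F v) λ x →
        Equiv.trans assoc (Equiv.trans (p v x) (Equiv.sym assoc))

    -- The unit at `X` of the adjunction between `X ↦ ∫^V X V · F V` and `Y ↦ C(F(-) , Y)`. For
    -- `F = J` it is the unit of the monad ν Lan; for `X = ν A′` and `F = (-) ◁ B` it is the
    -- universal map ν A′ → A((-) ◁ B , A′ ◁ᴶ B).
    unit : NaturalTransformation X (F₀ (HomAlong V C) (F , F₀ (CoendCopower V) (X , F)))
    unit .η v = coprojs V X F v
    unit .NaturalTransformation.commute f x =
      Equiv.trans (coproj-dinatural V X F f x) (Equiv.sym identityˡ)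

    module _ {Y : Obj} (α : NaturalTransformation X (F₀ (HomAlong V C) (F , Y))) where
      private
        leg : ∀ v → F₀ X v · F₀ F v ⇒ Y
        leg v = copair (F₀ X v) (F₀ F v) (η α v)

        leg-inj : ∀ v {S Z} (g : Func S (F₀ X v)) (h : Z ⇒ F₀ F v) s →
                  (leg v ∘ F₁ Copower (g , h)) ∘ inj S Z s ≈ (η α v ⟨$⟩ (g ⟨$⟩ s)) ∘ h
        leg-inj v {S} {Z} g h s = begin
          (leg v ∘ F₁ Copower (g , h)) ∘ inj S Z s
            ≈⟨ assoc ⟩
          leg v ∘ (F₁ Copower (g , h) ∘ inj S Z s)
            ≈⟨ ∘-resp-≈ʳ (copower₁-inj S (F₀ X v) Z (F₀ F v) g h s) ⟩
          leg v ∘ (inj (F₀ X v) (F₀ F v) (g ⟨$⟩ s) ∘ h)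
            ≈⟨ assoc ⟨
          (leg v ∘ inj (F₀ X v) (F₀ F v) (g ⟨$⟩ s)) ∘ h
            ≈⟨ ∘-resp-≈ˡ (copair-inj (F₀ X v) (F₀ F v) (η α v) (g ⟨$⟩ s)) ⟩
          (η α v ⟨$⟩ (g ⟨$⟩ s)) ∘ h
            ∎

        wedge : Cowedge V (F₀ (Copowers V) (X , F))
        wedge .Cowedge.E = Y
        wedge .Cowedge.ι = leg
        wedge .Cowedge.dinatural {v} {w} f = inj-epic (F₀ X w) (F₀ F v) λ x → begin
          (leg v ∘ F₁ Copower (F₁ X f , F₁ F V.id)) ∘ inj (F₀ X w) (F₀ F v) x
            ≈⟨ leg-inj v (F₁ X f) (F₁ F V.id) x ⟩
          (η α v ⟨$⟩ (F₁ X f ⟨$⟩ x)) ∘ F₁ F V.id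
            ≈⟨ ∘-resp-≈ʳ (Functor.identity F) ⟩
          (η α v ⟨$⟩ (F₁ X f ⟨$⟩ x)) ∘ id
            ≈⟨ identityʳ ⟩
          η α v ⟨$⟩ (F₁ X f ⟨$⟩ x)
            ≈⟨ NaturalTransformation.commute α f x ⟩
          id ∘ ((η α w ⟨$⟩ x) ∘ F₁ F f)
            ≈⟨ identityˡ ⟩
          (η α w ⟨$⟩ x) ∘ F₁ F f
            ≈⟨ ∘-resp-≈ˡ (Func.cong (η α w) (Functor.identity X x)) ⟨
          (η α w ⟨$⟩ (F₁ X V.id ⟨$⟩ x)) ∘ F₁ F f
            ≈⟨ leg-inj w (F₁ X V.id) (F₁ F f) x ⟨
          (leg w ∘ F₁ Copower (F₁ X V.id , F₁ F f)) ∘ inj (F₀ X w) (F₀ F v) x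
            ∎

      -- The transpose of `α` under this adjunction: `fold-coproj` factors `α` through `unit`, and
      -- `coproj-epic` makes the factorisation unique.
      fold : F₀ (CoendCopower V) (X , F) ⇒ Y
      fold = Coend.factor (coend V (F₀ (Copowers V) (X , F))) wedge

      fold-coproj : ∀ v x → fold ∘ coproj V X F v x ≈ η α v ⟨$⟩ x
      fold-coproj v x = begin
        fold ∘ coproj V X F v x
          ≈⟨ assoc ⟨
        (fold ∘ Coend.ι (coend V (F₀ (Copowers V) (X , F))) v) ∘ inj (F₀ X v) (F₀ F v) x
          ≈⟨ ∘-resp-≈ˡ (Coend.factor-ι (coend V (F₀ (Copowers V) (X , F))) wedge v) ⟩
        leg v ∘ inj (F₀ X v) (F₀ F v) x
          ≈⟨ copair-inj (F₀ X v) (F₀ F v) (η α v) x ⟩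
        η α v ⟨$⟩ x
          ∎

  -- Naturality of the coprojections in both arguments at once. Naturality of currying uses it
  -- twice: for the tensor, where both arguments move, and for the internal hom, where `β` is the
  -- identity of `J`.
  CoendCopower₁-coproj :
    ∀ {X Y : Functor (Op V) (Setoids ℓ)} {F G : Functor V C}
    (α : NaturalTransformation X Y) (β : NaturalTransformation F G) v x →
    F₁ (CoendCopower V) (α , β) ∘ coproj V X F v x ≈ coproj V Y G v (η α v ⟨$⟩ x) ∘ η β v
  CoendCopower₁-coproj {X} {Y} {F} {G} α β v x = begin
    F₁ (CoendCopower V) (α , β) ∘ coproj V X F v x
      ≈⟨ assoc ⟨
    (F₁ (CoendCopower V) (α , β) ∘ Coend.ι (coend V (F₀ (Copowers V) (X , F))) v)
      ∘ inj (F₀ X v) (F₀ F v) x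
      ≈⟨ ∘-resp-≈ˡ (Coend.factor-ι (coend V (F₀ (Copowers V) (X , F))) _ v) ⟩
    (Coend.ι (coend V (F₀ (Copowers V) (Y , G))) v ∘ F₁ Copower (η α v , η β v))
      ∘ inj (F₀ X v) (F₀ F v) x
      ≈⟨ assoc ⟩
    Coend.ι (coend V (F₀ (Copowers V) (Y , G))) v
      ∘ (F₁ Copower (η α v , η β v) ∘ inj (F₀ X v) (F₀ F v) x)
      ≈⟨ ∘-resp-≈ʳ (copower₁-inj (F₀ X v) (F₀ Y v) (F₀ F v) (F₀ G v) (η α v) (η β v) x) ⟩
    Coend.ι (coend V (F₀ (Copowers V) (Y , G))) v
      ∘ (inj (F₀ Y v) (F₀ G v) (η α v ⟨$⟩ x) ∘ η β v)
      ≈⟨ assoc ⟨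
    coproj V Y G v (η α v ⟨$⟩ x) ∘ η β v
      ∎

-- Density of `J`, read on arrows out of the objects `F₀ J v`.

module _ {V : Category ℓ ℓ} {A : Category o ℓ} (J : Functor V A) (dense : Dense J) where
  open Category A

  dense-epic : ∀ {X Y} {f g : X ⇒ Y} →
               (∀ v (x : F₀ J v ⇒ X) → f ∘ x ≈ g ∘ x) → f ≈ g
  -- The nerve sends `f` to `x ↦ f ∘ (x ∘ id)`, so injectivity asks for `p` at `x ∘ id`.
  dense-epic {X} {Y} p = proj₁ (dense X Y) λ v x → p v (x ∘ id)

  unnerve : ∀ {X Y} → NaturalTransformation (F₀ (nerve J) X) (F₀ (nerve J) Y) → X ⇒ Y
  unnerve {X} {Y} α = proj₁ (proj₂ (dense X Y) α)

  -- Fullness of the nerve as a computation rule; with `dense-epic` it determines `unnerve α`.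
  unnerve-∘ : ∀ {X Y} (α : NaturalTransformation (F₀ (nerve J) X) (F₀ (nerve J) Y)) →
              ∀ v x → unnerve α ∘ x ≈ η α v ⟨$⟩ x
  unnerve-∘ {X} {Y} α v x = Equiv.trans (∘-resp-≈ʳ (Equiv.sym identityʳ))
    (proj₂ (proj₂ (dense X Y) α) Equiv.refl v x)

  module _ (colim : Cocomplete A) where
    open HomReasoning
    open Colimits colim

    -- Fixed points of the idempotent monad ν Lan.

    module _ (X : Functor (Op V) (Setoids ℓ))
             (φ : Iso (Presheaves V) (F₀ (nerve J ∘F LanYoneda V J) X) X) where
      private
        module X (v : Category.Obj V) = Setoid (F₀ X v)

        LX : Obj
        LX = F₀ (LanYoneda V J) X

        κ : ∀ v → X.Carrier v → F₀ J v ⇒ LX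
        κ = coproj V X J

        κ-cong : ∀ {v x y} → X._≈_ v x y → κ v x ≈ κ v y
        κ-cong {v} = Func.cong (coprojs V X J v)

        -- The transpose of φ⁻¹ : X → ν LX, so that ν m ∘ unit = φ⁻¹.
        m : LX ⇒ LX
        m = fold colim X J (Iso.from φ)

        retract : NaturalTransformation (F₀ (nerve J) LX) X
        retract = Iso.to φ ∘N F₁ (nerve J) m

        -- By the choice of `m`, retract ∘ unit = φ ∘ ν m ∘ unit = φ ∘ φ⁻¹ = id.
        retract-κ : ∀ v x → X._≈_ v (η retract v ⟨$⟩ κ v x) x
        retract-κ v x = X.trans v
          (Func.cong (η (Iso.to φ) v) (begin
            m ∘ (κ v x ∘ id)          ≈⟨ ∘-resp-≈ʳ identityʳ ⟩
            m ∘ κ v x                 ≈⟨ fold-coproj colim X J (Iso.from φ) v x ⟩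
            η (Iso.from φ) v ⟨$⟩ x    ∎))
          (Iso.isoʳ φ v x)

      -- The composite unit ∘ retract is an endomorphism of ν LX, hence ν n for some `n` by
      -- fullness. By `retract-κ`, this `n` fixes every coprojection of LX, so it is the identity,
      -- and the left inverse is also a right inverse.
      unit-isIso : IsIso (Presheaves V) (unit colim X J)
      unit-isIso = record { inv = retract ; isoˡ = retract-κ ; isoʳ = κ-retract }
        where
        n : LX ⇒ LX
        n = unnerve (unit colim X J ∘N retract)

        n-id : n ≈ id
        n-id = coproj-epic colim X J λ v x → begin
          n ∘ κ v x                    ≈⟨ unnerve-∘ (unit colim X J ∘N retract) v (κ v x) ⟩
          κ v (η retract v ⟨$⟩ κ v x)  ≈⟨ κ-cong (retract-κ v x) ⟩
          κ v x                        ≈⟨ identityˡ ⟨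
          id ∘ κ v x                   ∎

        κ-retract : ∀ v f → κ v (η retract v ⟨$⟩ f) ≈ f
        κ-retract v f = begin
          κ v (η retract v ⟨$⟩ f)  ≈⟨ unnerve-∘ (unit colim X J ∘N retract) v f ⟨
          n ∘ f                    ≈⟨ ∘-resp-≈ˡ n-id ⟩
          id ∘ f                   ≈⟨ identityˡ ⟩
          f                        ∎

    -- Currying, with `F₀ K Y` in the role of (-) ◁ Y.

    module _ {B : Category o′ ℓ} (K : Functor B (Functors V A))
             (fixed : ∀ Y Z → Iso (Presheaves V)
               (F₀ (nerve J ∘F LanYoneda V J) (F₀ (HomAlong V A) (F₀ K Y , Z)))
               (F₀ (HomAlong V A) (F₀ K Y , Z))) where
      private
        module B = Category B

        infixr 8 _◂_
        _◂_ : Obj → B.Obj → Obj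
        X ◂ Y = F₀ (CoendCopower V) (F₀ (nerve J) X , F₀ K Y)

        K-hom : B.Obj → Obj → Functor (Op V) (Setoids ℓ)
        K-hom Y Z = F₀ (HomAlong V A) (F₀ K Y , Z)

        [_,_]ᴷ : B.Obj → Obj → Obj
        [ Y , Z ]ᴷ = F₀ (LanYoneda V J) (K-hom Y Z)

        π : ∀ {X Y} v → F₀ J v ⇒ X → F₀ (F₀ K Y) v ⇒ X ◂ Y
        π {X} {Y} v = coproj V (F₀ (nerve J) X) (F₀ K Y) v

        π-epic : ∀ {X Y Z} {f g : X ◂ Y ⇒ Z} →
                 (∀ v (x : F₀ J v ⇒ X) → f ∘ π v x ≈ g ∘ π v x) → f ≈ g
        π-epic {X} {Y} = coproj-epic colim (F₀ (nerve J) X) (F₀ K Y)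

        π-cong : ∀ {X Y v} {x y : F₀ J v ⇒ X} → x ≈ y → π {Y = Y} v x ≈ π v y
        π-cong {X} {Y} {v} = Func.cong (coprojs V (F₀ (nerve J) X) (F₀ K Y) v)

        κ : ∀ {Y Z} v → F₀ (F₀ K Y) v ⇒ Z → F₀ J v ⇒ [ Y , Z ]ᴷ
        κ {Y} {Z} v = coproj V (K-hom Y Z) J v

        κ-cong : ∀ {Y Z v} {x y : F₀ (F₀ K Y) v ⇒ Z} → x ≈ y → κ v x ≈ κ v y
        κ-cong {Y} {Z} {v} = Func.cong (coprojs V (K-hom Y Z) J v)

        module κ⁻¹ (Y : B.Obj) (Z : Obj) =
          IsIso (unit-isIso (K-hom Y Z) (fixed Y Z))

        κ⁻¹ : ∀ {Y Z} v → F₀ J v ⇒ [ Y , Z ]ᴷ → F₀ (F₀ K Y) v ⇒ Z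
        κ⁻¹ {Y} {Z} v x = η (κ⁻¹.inv Y Z) v ⟨$⟩ x

        κ⁻¹-cong : ∀ {Y Z v} {x y : F₀ J v ⇒ [ Y , Z ]ᴷ} → x ≈ y → κ⁻¹ v x ≈ κ⁻¹ v y
        κ⁻¹-cong {Y} {Z} {v} = Func.cong (η (κ⁻¹.inv Y Z) v)

        -- The composite ν X → A(K Y(-) , X ◂ Y) → A(K Y(-) , Z) → ν [ Y , Z ]ᴷ. Its last factor is
        -- the unit of ν Lan, which `fixed` makes invertible; this is what lets `uncurry` go back.
        transposed : ∀ {X Y Z} → X ◂ Y ⇒ Z →
                     NaturalTransformation (F₀ (nerve J) X) (F₀ (nerve J) [ Y , Z ]ᴷ)
        transposed {X} {Y} {Z} h = unit colim (K-hom Y Z) J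
          ∘N (F₁ (appˡ (HomAlong V A) (F₀ K Y)) h
          ∘N unit colim (F₀ (nerve J) X) (F₀ K Y))

        curry : ∀ {X Y Z} → X ◂ Y ⇒ Z → X ⇒ [ Y , Z ]ᴷ
        curry h = unnerve (transposed h)

        -- Together with `uncurry-π` this reduces the two inverse laws to cancelling `κ` against
        -- `κ⁻¹`, tested by `π-epic` on one side and by `dense-epic` on the other.
        curry-∘ : ∀ {X Y Z} (h : X ◂ Y ⇒ Z) v x → curry h ∘ x ≈ κ v (h ∘ π v x)
        curry-∘ h v x = Equiv.trans (unnerve-∘ (transposed h) v x)
          (κ-cong (∘-resp-≈ʳ identityʳ))

        curry-cong : ∀ {X Y Z} {h k : X ◂ Y ⇒ Z} → h ≈ k → curry h ≈ curry k
        curry-cong {h = h} {k} p = dense-epic λ v x → begin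
          curry h ∘ x      ≈⟨ curry-∘ h v x ⟩
          κ v (h ∘ π v x)  ≈⟨ κ-cong (∘-resp-≈ˡ p) ⟩
          κ v (k ∘ π v x)  ≈⟨ curry-∘ k v x ⟨
          curry k ∘ x      ∎

        uncurried : ∀ {X Y Z} → X ⇒ [ Y , Z ]ᴷ →
                    NaturalTransformation (F₀ (nerve J) X) (K-hom Y Z)
        uncurried {Y = Y} {Z} f = κ⁻¹.inv Y Z ∘N F₁ (nerve J) f

        uncurry : ∀ {X Y Z} → X ⇒ [ Y , Z ]ᴷ → X ◂ Y ⇒ Z
        uncurry {X} {Y} f = fold colim (F₀ (nerve J) X) (F₀ K Y) (uncurried f)

        uncurry-π : ∀ {X Y Z} (f : X ⇒ [ Y , Z ]ᴷ) v x → uncurry f ∘ π v x ≈ κ⁻¹ v (f ∘ x)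
        uncurry-π {X} {Y} f v x = Equiv.trans
          (fold-coproj colim (F₀ (nerve J) X) (F₀ K Y) (uncurried f) v x)
          (κ⁻¹-cong (∘-resp-≈ʳ identityʳ))

        uncurry-cong : ∀ {X Y Z} {f g : X ⇒ [ Y , Z ]ᴷ} → f ≈ g → uncurry f ≈ uncurry g
        uncurry-cong {f = f} {g} p = π-epic λ v x → begin
          uncurry f ∘ π v x  ≈⟨ uncurry-π f v x ⟩
          κ⁻¹ v (f ∘ x)      ≈⟨ κ⁻¹-cong (∘-resp-≈ˡ p) ⟩
          κ⁻¹ v (g ∘ x)      ≈⟨ uncurry-π g v x ⟨
          uncurry g ∘ π v x  ∎

        uncurry-curry : ∀ {X Y Z} (h : X ◂ Y ⇒ Z) → uncurry (curry h) ≈ h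
        uncurry-curry {Y = Y} {Z} h = π-epic λ v x → begin
          uncurry (curry h) ∘ π v x  ≈⟨ uncurry-π (curry h) v x ⟩
          κ⁻¹ v (curry h ∘ x)        ≈⟨ κ⁻¹-cong (curry-∘ h v x) ⟩
          κ⁻¹ v (κ v (h ∘ π v x))    ≈⟨ κ⁻¹.isoˡ Y Z v (h ∘ π v x) ⟩
          h ∘ π v x                  ∎

        curry-uncurry : ∀ {X Y Z} (f : X ⇒ [ Y , Z ]ᴷ) → curry (uncurry f) ≈ f
        curry-uncurry {Y = Y} {Z} f = dense-epic λ v x → begin
          curry (uncurry f) ∘ x      ≈⟨ curry-∘ (uncurry f) v x ⟩
          κ v (uncurry f ∘ π v x)    ≈⟨ κ-cong (uncurry-π f v x) ⟩
          κ v (κ⁻¹ v (f ∘ x))        ≈⟨ κ⁻¹.isoʳ Y Z v (f ∘ x) ⟩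
          f ∘ x                      ∎

      CoendCopower-adjunction : AdjunctionWithParameter
        (CoendCopower V ∘F (nerve J ⁂ K))
        (LanYoneda V J ∘F (HomAlong V A ∘F (opF K ⁂ idF)))
      CoendCopower-adjunction = record
        { iso = λ (X , Y , Z) → record
          { to    = record { to = curry ; cong = curry-cong }
          ; isIso = record
            { inv  = record { to = uncurry ; cong = uncurry-cong }
            ; isoˡ = uncurry-curry
            ; isoʳ = curry-uncurry
            }
          }
        ; commute = λ (a , b , c) h → curry-natural a b c h
        }
        where
        -- By density it suffices to precompose with each `x` out of `F₀ J v`. Both sides then
        -- become `κ` of the same arrow: naturality of `π` moves `a` and `b` inside, and naturality
        -- of `κ` in the presheaf absorbs `b` and `c`.
        curry-natural :
          ∀ {X X′ Y Y′ Z Z′} (a : X′ ⇒ X) (b : B [ Y′ , Y ]) (c : Z ⇒ Z′) (h : X ◂ Y ⇒ Z) →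
          curry (c ∘ (h ∘ F₁ (CoendCopower V ∘F (nerve J ⁂ K)) (a , b)))
          ≈ F₁ (LanYoneda V J ∘F (HomAlong V A ∘F (opF K ⁂ idF))) (b , c) ∘ (curry h ∘ a)
        curry-natural {X} {X′} {Y} {Y′} {Z} {Z′} a b c h = dense-epic λ v x → begin
          curry (c ∘ (h ∘ ab)) ∘ x
            ≈⟨ curry-∘ (c ∘ (h ∘ ab)) v x ⟩
          κ v ((c ∘ (h ∘ ab)) ∘ π v x)
            ≈⟨ κ-cong (Equiv.trans assoc (∘-resp-≈ʳ assoc)) ⟩
          κ v (c ∘ (h ∘ (ab ∘ π v x)))
            ≈⟨ κ-cong (∘-resp-≈ʳ (∘-resp-≈ʳ
                 (CoendCopower₁-coproj colim (F₁ (nerve J) a) (F₁ K b) v x))) ⟩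
          κ v (c ∘ (h ∘ (π v (a ∘ (x ∘ id)) ∘ η (F₁ K b) v)))
            ≈⟨ κ-cong (∘-resp-≈ʳ (∘-resp-≈ʳ
                 (∘-resp-≈ˡ (π-cong (∘-resp-≈ʳ identityʳ))))) ⟩
          κ v (c ∘ (h ∘ (π v (a ∘ x) ∘ η (F₁ K b) v)))
            ≈⟨ κ-cong (∘-resp-≈ʳ assoc) ⟨
          κ v (c ∘ ((h ∘ π v (a ∘ x)) ∘ η (F₁ K b) v))
            -- `bc` changes only the presheaf and keeps `J` fixed, so its value on a coprojection
            -- carries a trailing component of `idN`.
            ≈⟨ identityʳ ⟨
          κ v (c ∘ ((h ∘ π v (a ∘ x)) ∘ η (F₁ K b) v)) ∘ id
            ≈⟨ CoendCopower₁-coproj colim (F₁ (HomAlong V A) (F₁ K b , c)) idN v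
                 (h ∘ π v (a ∘ x)) ⟨
          bc ∘ κ v (h ∘ π v (a ∘ x))
            ≈⟨ ∘-resp-≈ʳ (curry-∘ h v (a ∘ x)) ⟨
          bc ∘ (curry h ∘ (a ∘ x))
            ≈⟨ ∘-resp-≈ʳ assoc ⟨
          bc ∘ ((curry h ∘ a) ∘ x)
            ≈⟨ assoc ⟨
          (bc ∘ (curry h ∘ a)) ∘ x
            ∎
          where
          ab : X′ ◂ Y′ ⇒ X ◂ Y
          ab = F₁ (CoendCopower V ∘F (nerve J ⁂ K)) (a , b)

          bc : [ Y , Z ]ᴷ ⇒ [ Y′ , Z′ ]ᴷ
          bc = F₁ (LanYoneda V J ∘F (HomAlong V A ∘F (opF K ⁂ idF))) (b , c)

theorem4p10 :
  ∀ {o ℓ} (A : Category o ℓ) (colim : Cocomplete A)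
    (V : Category ℓ ℓ) (M : Monoidal V) (act : Action M A)
    (Jᴵ : Category.Obj A) →
  let open Extension colim act Jᴵ
      open Colimits
  in
  (∀ X → WellBehaved colim J (appʳ ◁ X)) →
  NaturalIsomorphism (◁ᴶ ∘F ((◁ ⁂ idF) ∘F assocF)) (◁ ∘F (idF ⁂ ◁ᴶ)) →
  (∀ X Y → Iso (Presheaves V)
               (F₀ (nerve J ∘F LanYoneda colim V J) (F₀ ◁-hom (X , Y)))
               (F₀ ◁-hom (X , Y))) →
  AdjunctionWithParameter ◁ᴶ [-,-]⋄
theorem4p10 A colim V M act Jᴵ wellBehaved _ fixed =
  -- Density of `J` does not involve the object at which well-behavedness is taken, so any object
  -- serves, and `Jᴵ` is at hand. With `◁-curried` for `K`, the two functors of the adjunction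
  -- unfold to `◁ᴶ` and `[-,-]⋄`.
  CoendCopower-adjunction J (WellBehaved.dense (wellBehaved Jᴵ)) colim ◁-curried fixed
  where open Extension colim act Jᴵ
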